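{- Let $H$ be a bull or a hammer, and let $\mathcal{C}$ be the class of $(C_4,H)$-free graphs. Then $\mathcal{C}$ is $2$-strongly linear-Pollyanna.
   Context: All graphs are finite and simple. $\omega(G)$ is the clique number and $\chi(G)$ the chromatic number of $G$. For graphs $H_1,\dots,H_t$, a graph $G$ is $(H_1,\dots,H_t)$-free if no induced subgraph of $G$ is isomorphic to any $H_i$. $C_4$ is the cycle on 4 vertices. A bull is the 5-vertex graph consisting of a triangle with two disjoint pendant edges (i.e. pendant edges attached at two distinct vertices of the triangle). A hammer is the 5-vertex graph obtained by identifying an endvertex of a path on 3 vertices with a vertex of a triangle. A class of graphs is hereditary if it is closed under taking induced subgraphs. A class $\mathcal{F}$ of graphs is $\chi$-bounded with binding function $f$ if $\chi(G)\le f(\omega(G))$ for all induced subgraphs $G$ of graphs in $\mathcal{F}$; it is linearly $\chi$-bounded if it has a binding function that is a linear polynomial. For a positive integer $n$, a class $\mathcal{F}$ of graphs is $n$-good if it is hereditary and there is a constant $m$ such that $\chi(G)\le m$ for every $G\in\mathcal{F}$ with $\omega(G)\le n$. A class $\mathcal{C}$ of graphs is $n$-strongly linear-Pollyanna if $\mathcal{C}\cap\mathcal{F}$ is linearly $\chi$-bounded for every $n$-good class $\mathcal{F}$ of graphs. -}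

module Defs where

open import Data.Fin using (Fin; #_; finToFun; funToFin)
open import Data.Fin.Properties
  using (all?; any?; finToFun-funToFin) renaming (_≟_ to _≟ᶠ_)
open import Data.Fin.Subset using (Subset; _∈_; ∣_∣; ⊥)
open import Data.Fin.Subset.Properties
  using (_∈?_; anySubset?; ∣p∣≤n; ∣⊥∣≡0; ∉⊥)
open import Data.List.Base using (List; []; _∷_)
open import Data.List.Relation.Unary.All using (All)
import Data.List.Membership.DecPropositional as DecMembership
open import Data.List.Membership.Propositional using () renaming (_∈_ to _∈ˡ_)
open import Data.Nat.Base using (ℕ; zero; suc; _+_; _*_; _≤_; z≤n; s≤s; NonZero)
open import Data.Nat.Properties using (_≟_; ≤-pred; ≤∧≢⇒<)
open import Data.Product.Base using (Σ; ∃; ∃₂; ∃-syntax; _×_; _,_; proj₁)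
open import Data.Product.Properties using (≡-dec)
open import Data.Sum.Base using (_⊎_; swap)
open import Function.Base using (_∘_; id)
open import Function.Bundles using (_⇔_)
open import Function.Definitions using (Injective)
open import Level using (Level; 0ℓ; _⊔_) renaming (suc to lsuc)
open import Relation.Binary.Core using (Rel)
open import Relation.Binary.Definitions
  using (Irreflexive; Symmetric) renaming (Decidable to Decidable₂)
open import Relation.Binary.PropositionalEquality
  using (_≡_; _≢_; refl; sym; subst; subst₂)
open import Relation.Nullary.Decidable
  using (yes; no; map′; ¬?; _×-dec_; _⊎-dec_; _→-dec_)
open import Relation.Nullary.Negation using (¬_; contradiction)
open import Relation.Unary using (Pred; Decidable; _∩_)

private
  variable
    c ℓ : Level

record Graph : Set₁ where
  field
    order  : ℕ
    Adj    : Rel (Fin order) 0ℓ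
    adj?   : Decidable₂ Adj
    irrefl : Irreflexive _≡_ Adj
    symm   : Symmetric Adj

  Vertex : Set
  Vertex = Fin order

open Graph public using (order; Adj; adj?; Vertex)

-- H ↪ G says that H is isomorphic to an induced subgraph of G, namely the one
-- induced on the image of the embedding.
infix 4 _↪_
record _↪_ (H G : Graph) : Set where
  field
    to        : Vertex H → Vertex G
    injective : Injective _≡_ _≡_ to
    adjacent  : ∀ u v → Adj H u v ⇔ Adj G (to u) (to v)

Free : List Graph → Pred Graph (lsuc 0ℓ)
Free Hs G = All (λ H → ¬ (H ↪ G)) Hs

-- The simple graph on Fin n whose edges are the listed pairs, unordered;
-- a pair (v , v) contributes nothing.
fromEdges : (n : ℕ) → List (Fin n × Fin n) → Graph
fromEdges n es .Graph.order = n
fromEdges n es .Graph.Adj u v = u ≢ v × ((u , v) ∈ˡ es ⊎ (v , u) ∈ˡ es)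
fromEdges n es .Graph.adj? u v =
  ¬? (u ≟ᶠ v) ×-dec (((u , v) ∈ˡ? es) ⊎-dec ((v , u) ∈ˡ? es))
  where open DecMembership (≡-dec (_≟ᶠ_ {n}) (_≟ᶠ_ {n})) using () renaming (_∈?_ to _∈ˡ?_)
fromEdges n es .Graph.irrefl u≡v (u≢v , _) = u≢v u≡v
fromEdges n es .Graph.symm (u≢v , e) = u≢v ∘ sym , swap e

C₄ : Graph
C₄ = fromEdges 4 ((# 0 , # 1) ∷ (# 1 , # 2) ∷ (# 2 , # 3) ∷ (# 3 , # 0) ∷ [])

-- The triangle is 0 1 2 in both graphs.
bull : Graph
bull = fromEdges 5
  ((# 0 , # 1) ∷ (# 1 , # 2) ∷ (# 2 , # 0) ∷ (# 0 , # 3) ∷ (# 1 , # 4) ∷ [])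

hammer : Graph
hammer = fromEdges 5
  ((# 0 , # 1) ∷ (# 1 , # 2) ∷ (# 2 , # 0) ∷ (# 2 , # 3) ∷ (# 3 , # 4) ∷ [])

IsLeast IsGreatest : Pred ℕ ℓ → Pred ℕ ℓ
IsLeast    P k = P k × (∀ {j} → P j → k ≤ j)
IsGreatest P k = P k × (∀ {j} → P j → j ≤ k)

least : {P : Pred ℕ ℓ} → Decidable P → ∀ b → P b → ∃ (IsLeast P)
least P? zero    p = 0 , p , λ _ → z≤n
least {P = P} P? (suc b) p with P? 0
... | yes p₀ = 0 , p₀ , λ _ → z≤n
... | no ¬p₀ with least (P? ∘ suc) b p
...   | k , pk , min = suc k , pk , bound
  where
  bound : ∀ {j} → P j → suc k ≤ j
  bound {zero}  p₀ = contradiction p₀ ¬p₀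
  bound {suc j} pj = s≤s (min pj)

greatest : {P : Pred ℕ ℓ} → Decidable P → P 0 →
           ∀ b → (∀ {j} → P j → j ≤ b) → ∃ (IsGreatest P)
greatest P? p₀ zero    bound = 0 , p₀ , bound
greatest {P = P} P? p₀ (suc b) bound with P? (suc b)
... | yes p = suc b , p , bound
... | no ¬p = greatest P? p₀ b λ pj →
        ≤-pred (≤∧≢⇒< (bound pj) λ j≡1+b → ¬p (subst P j≡1+b pj))

module _ (G : Graph) where

  IsClique : Pred (Subset (order G)) 0ℓ
  IsClique S = ∀ u v → u ∈ S → v ∈ S → u ≢ v → Adj G u v

  HasClique : Pred ℕ 0ℓ
  HasClique k = ∃[ S ] IsClique S × ∣ S ∣ ≡ k

  IsProper : {k : ℕ} → Pred (Vertex G → Fin k) 0ℓ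
  IsProper f = ∀ u v → Adj G u v → f u ≢ f v

  Colourable : Pred ℕ 0ℓ
  Colourable k = Σ (Vertex G → Fin k) IsProper

  isClique? : Decidable IsClique
  isClique? S = all? λ u → all? λ v →
    (u ∈? S) →-dec ((v ∈? S) →-dec (¬? (u ≟ᶠ v) →-dec adj? G u v))

  hasClique? : Decidable HasClique
  hasClique? k = anySubset? λ S → isClique? S ×-dec (∣ S ∣ ≟ k)

  isProper? : {k : ℕ} → Decidable (IsProper {k})
  isProper? f = all? λ u → all? λ v → adj? G u v →-dec ¬? (f u ≟ᶠ f v)

  colourable? : Decidable Colourable
  colourable? k = map′
    (λ (i , p) → finToFun i , p)
    (λ (f , p) → funToFin f , λ u v uv eq → p u v uv
      (subst₂ _≡_ (finToFun-funToFin f u) (finToFun-funToFin f v) eq))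
    (any? λ i → isProper? (finToFun {k} {order G} i))

  cliqueNumber : ∃ (IsGreatest HasClique)
  cliqueNumber = greatest hasClique?
    (⊥ , (λ _ _ u∈⊥ → contradiction u∈⊥ ∉⊥) , ∣⊥∣≡0 (order G))
    (order G) (λ where (S , _ , refl) → ∣p∣≤n S)

  chromaticNumber : ∃ (IsLeast Colourable)
  chromaticNumber = least colourable? (order G)
    (id , λ u v uv u≡v → Graph.irrefl G u≡v uv)

  ω χ : ℕ
  ω = proj₁ cliqueNumber
  χ = proj₁ chromaticNumber

Hereditary : Pred Graph ℓ → Set (lsuc 0ℓ ⊔ ℓ)
Hereditary F = ∀ {G H} → F G → H ↪ G → F H

BindingFunction : Pred Graph ℓ → (ℕ → ℕ) → Set (lsuc 0ℓ ⊔ ℓ)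
BindingFunction F f = ∀ {G H} → F G → H ↪ G → χ H ≤ f (ω H)

-- Natural coefficients lose no generality for binding functions: any real
-- linear polynomial is bounded above on ℕ by one of this form.
IsLinear : Pred (ℕ → ℕ) 0ℓ
IsLinear f = ∃₂ λ a b → NonZero a × (∀ x → f x ≡ a * x + b)

LinearlyχBounded : Pred Graph ℓ → Set (lsuc 0ℓ ⊔ ℓ)
LinearlyχBounded F = ∃[ f ] IsLinear f × BindingFunction F f

Good : (n : ℕ) .{{_ : NonZero n}} → Pred Graph ℓ → Set (lsuc 0ℓ ⊔ ℓ)
Good n F = Hereditary F × ∃[ m ] (∀ {G} → F G → ω G ≤ n → χ G ≤ m)

StronglyLinearPollyanna : ∀ ℓ (n : ℕ) .{{_ : NonZero n}} →
                          Pred Graph c → Set (lsuc 0ℓ ⊔ c ⊔ lsuc ℓ)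
StronglyLinearPollyanna ℓ n C =
  (F : Pred Graph ℓ) → Good n F → LinearlyχBounded (C ∩ F)

{-# OPTIONS --safe #-}

-- Let n ≥ ω(G) and let S be a set of vertices of least size meeting every
-- n-clique of G.  By minimality every s ∈ S lies in a private n-clique K(s),
-- one with K(s) ∩ S = {s}.  Suppose s, t, u ∈ S form a triangle.  As G is
-- C₄-free, the non-neighbourhoods of t and u in K(s) are nested, so some
-- k ∈ K(s) misses both; likewise some k′ ∈ K(t) misses s and u.  Again by
-- C₄-freeness k ≁ k′, so s, t, u, k, k′ induce a bull.  If j ≠ k is another
-- non-neighbour of t in K(s), then k, j, s, t, k′ induce a hammer; so in a
-- hammer-free graph k is the only non-neighbour of t, and likewise of u, in
-- K(s), and K(s) - k + t + u is a clique with n + 1 vertices.  Hence G[S] is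
-- triangle-free, and removing S lowers the clique number, which gives
-- χ(G) ≤ m ω(G) by induction on the clique number.
module Submission where

open import Defs
open import Data.Bool.Base using (if_then_else_)
open import Data.Empty using (⊥-elim)
open import Data.Fin.Base using (Fin; zero; suc; _<_; join; splitAt; inject≤)
open import Data.Fin.Properties
  using (all?; ¬∀⟶∃¬; <-cmp; splitAt-join; suc-injective; inject≤-injective)
  renaming (_≟_ to _≟ᶠ_)
open import Data.Fin.Subset
  using (Subset; inside; outside; _∈_; _∉_; _⊆_; Nonempty; ∣_∣; ⁅_⁆; _∪_; _-_; ∁; ⊤)
open import Data.Fin.Subset.Properties
open import Data.List.Base using ([]; _∷_; allFin; tabulate)
open import Data.List.Relation.Unary.All using ([]; _∷_)
import Data.List.Relation.Unary.All.Properties as All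
open import Data.List.Relation.Unary.AllPairs using (AllPairs; []; _∷_)
open import Data.Nat.Base as ℕ using (ℕ; zero; suc; _+_; _*_; _≤_; z≤n; s≤s)
import Data.Nat.Properties as ℕ
open import Data.Product.Base using (∃-syntax; _×_; _,_; proj₁; proj₂)
open import Data.Sum.Base using (_⊎_; inj₁; inj₂)
open import Data.Sum.Properties using (inj₁-injective; inj₂-injective)
open import Data.Vec.Base using ([]; _∷_; here; there; lookup)
open import Function.Base using (_∘_)
open import Function.Bundles using (_⇔_; mk⇔; Equivalence)
open import Function.Construct.Composition using (_⇔-∘_)
open import Function.Construct.Identity using (⇔-id)
open import Function.Definitions using (Injective)
open import Level using (Level)
open import Relation.Binary.Core using (Rel)
open import Relation.Binary.Definitions using (tri<; tri≈; tri>)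
open import Relation.Binary.PropositionalEquality
  using (_≡_; _≢_; refl; sym; trans; cong; subst; subst₂)
open import Relation.Nullary.Decidable
  using (Dec; yes; no; does; ¬?; _×-dec_; _→-dec_; decidable-stable; from-yes)
open import Relation.Nullary.Negation using (¬_; contradiction)
open import Relation.Unary using (Pred; _∩_)

private
  variable
    c ℓ : Level
    n : ℕ

-- Sizes of finite subsets.

x∉p-x : (p : Subset n) (x : Fin n) → x ∉ p - x
x∉p-x (_ ∷ p) (suc x) (there x∈p) = x∉p-x p x x∈p

∣p∣≤1+∣p-x∣ : (p : Subset n) (x : Fin n) → ∣ p ∣ ≤ suc ∣ p - x ∣
∣p∣≤1+∣p-x∣ (inside  ∷ p) zero    = s≤s (ℕ.≤-reflexive (cong ∣_∣ (sym (p─⊥≡p p))))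
∣p∣≤1+∣p-x∣ (outside ∷ p) zero    = ℕ.m≤n⇒m≤1+n (ℕ.≤-reflexive (cong ∣_∣ (sym (p─⊥≡p p))))
∣p∣≤1+∣p-x∣ (inside  ∷ p) (suc x) = s≤s (∣p∣≤1+∣p-x∣ p x)
∣p∣≤1+∣p-x∣ (outside ∷ p) (suc x) = ∣p∣≤1+∣p-x∣ p x

0<∣p∣⇒Nonempty : (p : Subset n) → 0 ℕ.< ∣ p ∣ → Nonempty p
0<∣p∣⇒Nonempty (inside  ∷ p) _   = zero , here
0<∣p∣⇒Nonempty (outside ∷ p) 0<p with x , x∈p ← 0<∣p∣⇒Nonempty p 0<p = suc x , there x∈p

1+m≤∣p∣⇒m≤∣p-x∣ : ∀ {m} (p : Subset n) x → suc m ≤ ∣ p ∣ → m ≤ ∣ p - x ∣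
1+m≤∣p∣⇒m≤∣p-x∣ p x m<∣p∣ = ℕ.≤-pred (ℕ.≤-trans m<∣p∣ (∣p∣≤1+∣p-x∣ p x))

-- Supplies the triangle inside a clique with at least three vertices.
threeElements : (p : Subset n) → 3 ≤ ∣ p ∣ →
  ∃[ x ] ∃[ y ] ∃[ z ] (x ∈ p × y ∈ p × z ∈ p × x ≢ y × x ≢ z × y ≢ z)
threeElements p 3≤∣p∣
  with x , x∈p ← 0<∣p∣⇒Nonempty p (ℕ.≤-trans (s≤s z≤n) 3≤∣p∣)
  with 2≤∣p₁∣ ← 1+m≤∣p∣⇒m≤∣p-x∣ p x 3≤∣p∣
  with y , y∈p₁ ← 0<∣p∣⇒Nonempty (p - x) (ℕ.≤-trans (s≤s z≤n) 2≤∣p₁∣)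
  with z , z∈p₂ ← 0<∣p∣⇒Nonempty (p - x - y) (1+m≤∣p∣⇒m≤∣p-x∣ (p - x) y 2≤∣p₁∣)
  with z∈p₁ ← p─q⊆p (p - x) ⁅ y ⁆ z∈p₂
  = x , y , z , x∈p , p─q⊆p p ⁅ x ⁆ y∈p₁ , p─q⊆p p ⁅ x ⁆ z∈p₁
  , (λ { refl → x∉p-x p x y∈p₁ })
  , (λ { refl → x∉p-x p x z∈p₁ })
  , (λ { refl → x∉p-x (p - x) y z∈p₂ })

-- Enumeration of a subset, induced subgraphs and hereditary classes.

element : (S : Subset n) → Fin ∣ S ∣ → Fin n
element (inside  ∷ S) zero    = zero
element (inside  ∷ S) (suc i) = suc (element S i)
element (outside ∷ S) i       = suc (element S i)

element-injective : (S : Subset n) → Injective _≡_ _≡_ (element S)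
element-injective (inside  ∷ S) {zero}  {zero}  _  = refl
element-injective (inside  ∷ S) {suc i} {suc j} eq =
  cong suc (element-injective S (suc-injective eq))
element-injective (outside ∷ S) eq = element-injective S (suc-injective eq)

element-∈ : (S : Subset n) (i : Fin ∣ S ∣) → element S i ∈ S
element-∈ (inside  ∷ S) zero    = here
element-∈ (inside  ∷ S) (suc i) = there (element-∈ S i)
element-∈ (outside ∷ S) i       = there (element-∈ S i)

index : {S : Subset n} {x : Fin n} → x ∈ S → Fin ∣ S ∣
index {S = inside  ∷ S} here        = zero
index {S = inside  ∷ S} (there x∈S) = suc (index x∈S)
index {S = outside ∷ S} (there x∈S) = index x∈S

element-index : {S : Subset n} {x : Fin n} (x∈S : x ∈ S) → element S (index x∈S) ≡ x
element-index {S = inside  ∷ S} here        = refl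
element-index {S = inside  ∷ S} (there x∈S) = cong suc (element-index x∈S)
element-index {S = outside ∷ S} (there x∈S) = cong suc (element-index x∈S)

-- The image of `Q` under `element S`. Recursion along `S` makes its size immediate, so cliques of
-- an induced subgraph transfer to `G` with their size.
expand : (S : Subset n) → Subset ∣ S ∣ → Subset n
expand []            []      = []
expand (inside  ∷ S) (q ∷ Q) = q ∷ expand S Q
expand (outside ∷ S) Q       = outside ∷ expand S Q

∣expand∣ : (S : Subset n) (Q : Subset ∣ S ∣) → ∣ expand S Q ∣ ≡ ∣ Q ∣
∣expand∣ []            []            = refl
∣expand∣ (inside  ∷ S) (inside  ∷ Q) = cong suc (∣expand∣ S Q)
∣expand∣ (inside  ∷ S) (outside ∷ Q) = ∣expand∣ S Q
∣expand∣ (outside ∷ S) Q             = ∣expand∣ S Q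

∈-expand⁻ : (S : Subset n) (Q : Subset ∣ S ∣) {x : Fin n} →
            x ∈ expand S Q → ∃[ i ] i ∈ Q × x ≡ element S i
∈-expand⁻ (inside ∷ S) (inside ∷ Q) here = zero , here , refl
∈-expand⁻ (inside ∷ S) (_ ∷ Q) (there x∈) with i , i∈Q , refl ← ∈-expand⁻ S Q x∈ =
  suc i , there i∈Q , refl
∈-expand⁻ (outside ∷ S) Q (there x∈) with i , i∈Q , refl ← ∈-expand⁻ S Q x∈ =
  i , i∈Q , refl

induced : (G : Graph) → Subset (order G) → Graph
induced G S .Graph.order     = ∣ S ∣
induced G S .Graph.Adj u v   = Adj G (element S u) (element S v)
induced G S .Graph.adj? u v  = adj? G (element S u) (element S v)
induced G S .Graph.irrefl eq = Graph.irrefl G (cong (element S) eq)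
induced G S .Graph.symm      = Graph.symm G

induced-↪ : (G : Graph) (S : Subset (order G)) → induced G S ↪ G
induced-↪ G S ._↪_.to           = element S
induced-↪ G S ._↪_.injective    = element-injective S
induced-↪ G S ._↪_.adjacent _ _ = ⇔-id _

↪-trans : ∀ {G H K} → G ↪ H → H ↪ K → G ↪ K
↪-trans f g ._↪_.to           = _↪_.to g ∘ _↪_.to f
↪-trans f g ._↪_.injective    = _↪_.injective f ∘ _↪_.injective g
↪-trans f g ._↪_.adjacent _ _ = _↪_.adjacent g _ _ ⇔-∘ _↪_.adjacent f _ _

Free-hereditary : ∀ Hs → Hereditary (Free Hs)
Free-hereditary []       []           _   = []
Free-hereditary (H ∷ Hs) (H↪̸G ∷ free) K↪G =
  (λ H↪K → H↪̸G (↪-trans H↪K K↪G)) ∷ Free-hereditary Hs free K↪G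

∩-hereditary : {C : Pred Graph c} {F : Pred Graph ℓ} →
               Hereditary C → Hereditary F → Hereditary (C ∩ F)
∩-hereditary C-hereditary F-hereditary (CG , FG) H↪G =
  C-hereditary CG H↪G , F-hereditary FG H↪G

-- Transferring and enlarging cliques.

expand-isClique : (G : Graph) (S : Subset (order G)) {Q : Subset ∣ S ∣} →
                  IsClique (induced G S) Q → IsClique G (expand S Q)
expand-isClique G S {Q} clique u v u∈ v∈ u≢v
  with i , i∈Q , refl ← ∈-expand⁻ S Q u∈
     | j , j∈Q , refl ← ∈-expand⁻ S Q v∈
  = clique i j i∈Q j∈Q (u≢v ∘ cong (element S))

∪-isClique : (G : Graph) {Q : Subset (order G)} {v : Vertex G} →
             IsClique G Q → (∀ x → x ∈ Q → Adj G v x) → IsClique G (⁅ v ⁆ ∪ Q)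
∪-isClique G {Q} {v} clique v~Q x y x∈ y∈ x≢y
  with x∈p∪q⁻ ⁅ v ⁆ Q x∈ | x∈p∪q⁻ ⁅ v ⁆ Q y∈
... | inj₂ x∈Q | inj₂ y∈Q = clique x y x∈Q y∈Q x≢y
... | inj₁ x≡v | inj₁ y≡v =
      contradiction (trans (x∈⁅y⁆⇒x≡y v x≡v) (sym (x∈⁅y⁆⇒x≡y v y≡v))) x≢y
... | inj₁ x≡v | inj₂ y∈Q rewrite x∈⁅y⁆⇒x≡y v x≡v = v~Q y y∈Q
... | inj₂ x∈Q | inj₁ y≡v rewrite x∈⁅y⁆⇒x≡y v y≡v = Graph.symm G (v~Q x x∈Q)

∣p∣<∣⁅x⁆∪p∣ : {p : Subset n} {x : Fin n} → x ∉ p → ∣ p ∣ ℕ.< ∣ ⁅ x ⁆ ∪ p ∣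
∣p∣<∣⁅x⁆∪p∣ {p = p} {x} x∉p =
  p⊂q⇒∣p∣<∣q∣ (q⊆p∪q ⁅ x ⁆ p , x , p⊆p∪q p (x∈⁅x⁆ x) , x∉p)

Adj⇒≢ : (G : Graph) {u v : Vertex G} → Adj G u v → u ≢ v
Adj⇒≢ G u~v u≡v = Graph.irrefl G u≡v u~v

-- Embeddings of small concrete graphs.

AllPairs-tabulate⁻ : ∀ {a} {A : Set a} {R : Rel A ℓ} {f : Fin n → A} →
                     AllPairs R (tabulate f) → ∀ {i j} → i < j → R (f i) (f j)
AllPairs-tabulate⁻ (r ∷ _)  {zero}  {suc j} _         = All.tabulate⁻ r j
AllPairs-tabulate⁻ (_ ∷ rs) {suc i} {suc j} (s≤s i<j) = AllPairs-tabulate⁻ rs i<j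

-- For a concrete graph H each entry of AllPairs Agrees computes to an edge or
-- a non-edge of G.
module _ (H G : Graph) (f : Vertex H → Vertex G) where

  Agrees : Vertex H → Vertex H → Set
  Agrees u v = if does (adj? H u v) then Adj G (f u) (f v) else ¬ Adj G (f u) (f v)

  Agrees⇒⇔ : ∀ u v → Agrees u v → Adj H u v ⇔ Adj G (f u) (f v)
  Agrees⇒⇔ u v agrees with adj? H u v
  ... | yes u~v = mk⇔ (λ _ → agrees) (λ _ → u~v)
  ... | no  u≁v = mk⇔ (λ u~v → contradiction u~v u≁v) (λ e → contradiction e agrees)

  -- Symmetry and irreflexivity of both graphs reduce the claim to pairs `u < v`, exactly those that
  -- `AllPairs` over `allFin` covers.
  agrees⇒adjacent : AllPairs Agrees (allFin (order H)) →
                    ∀ u v → Adj H u v ⇔ Adj G (f u) (f v)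
  agrees⇒adjacent agrees u v with <-cmp u v
  ... | tri< u<v _ _ = Agrees⇒⇔ u v (AllPairs-tabulate⁻ agrees u<v)
  ... | tri≈ _ u≡v _ = mk⇔ (λ e → contradiction e (Graph.irrefl H u≡v))
                           (λ e → contradiction e (Graph.irrefl G (cong f u≡v)))
  ... | tri> _ _ v<u = mk⇔ (Graph.symm G ∘ to ∘ Graph.symm H)
                           (Graph.symm H ∘ from ∘ Graph.symm G)
    where open Equivalence (Agrees⇒⇔ v u (AllPairs-tabulate⁻ agrees v<u))

  allPairs-≢⇒injective : AllPairs (λ u v → f u ≢ f v) (allFin (order H)) →
                         Injective _≡_ _≡_ f
  allPairs-≢⇒injective distinct {u} {v} eq with <-cmp u v
  ... | tri< u<v _ _ = contradiction eq (AllPairs-tabulate⁻ distinct u<v)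
  ... | tri≈ _ u≡v _ = u≡v
  ... | tri> _ _ v<u = contradiction (sym eq) (AllPairs-tabulate⁻ distinct v<u)

-- Distinct vertices have distinct neighbourhoods. This holds for the bull and the hammer; it fails
-- for `C₄`, whose opposite vertices are twins.
TwinFree : Graph → Set
TwinFree H = ∀ u v → (∀ w → (Adj H u w → Adj H v w) × (Adj H v w → Adj H u w)) → u ≡ v

twinFree? : (H : Graph) → Dec (TwinFree H)
twinFree? H = all? λ u → all? λ v →
  (all? λ w → (adj? H u w →-dec adj? H v w) ×-dec (adj? H v w →-dec adj? H u w))
    →-dec (u ≟ᶠ v)

-- Vertices with the same image have the same neighbours in `H`, so injectivity comes for free.
twinFree⇒embedding : (H G : Graph) → TwinFree H → (f : Vertex H → Vertex G) →
                     AllPairs (Agrees H G f) (allFin (order H)) → H ↪ G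
twinFree⇒embedding H G twinFree f agrees = record
  { to = f ; injective = injective ; adjacent = adjacent }
  where
  adjacent = agrees⇒adjacent H G f agrees
  module A u v = Equivalence (adjacent u v)

  injective : Injective _≡_ _≡_ f
  injective {u} {v} eq = twinFree u v λ w →
      (λ u~w → A.from v w (subst (λ x → Adj G x (f w)) eq (A.to u w u~w)))
    , (λ v~w → A.from u w (subst (λ x → Adj G x (f w)) (sym eq) (A.to v w v~w)))

module _ (G : Graph) where
  private
    infix 4 _~_ _≁_
    _~_ _≁_ : Vertex G → Vertex G → Set
    u ~ v = Adj G u v
    u ≁ v = ¬ Adj G u v

  -- Twins may be identified by an adjacency-preserving map, hence the explicit `a ≢ c` and `b ≢ d`.
  C₄-embedding : ∀ {a b c d} → a ~ b → b ~ c → c ~ d → a ~ d → a ≁ c → b ≁ d →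
                 a ≢ c → b ≢ d → C₄ ↪ G
  C₄-embedding {a} {b} {c} {d} a~b b~c c~d a~d a≁c b≁d a≢c b≢d = record
    { to        = f
    ; injective = allPairs-≢⇒injective C₄ G f
        ((Adj⇒≢ G a~b ∷ a≢c ∷ Adj⇒≢ G a~d ∷ []) ∷ (Adj⇒≢ G b~c ∷ b≢d ∷ []) ∷
         (Adj⇒≢ G c~d ∷ []) ∷ [] ∷ [])
    ; adjacent  = agrees⇒adjacent C₄ G f
        ((a~b ∷ a≁c ∷ a~d ∷ []) ∷ (b~c ∷ b≁d ∷ []) ∷ (c~d ∷ []) ∷ [] ∷ [])
    }
    where f = lookup (a ∷ b ∷ c ∷ d ∷ [])

  bull-embedding : ∀ {a b c p q} → a ~ b → b ~ c → a ~ c → a ~ p → b ~ q →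
                   a ≁ q → b ≁ p → c ≁ p → c ≁ q → p ≁ q → bull ↪ G
  bull-embedding {a} {b} {c} {p} {q} a~b b~c a~c a~p b~q a≁q b≁p c≁p c≁q p≁q =
    twinFree⇒embedding bull G (from-yes (twinFree? bull))
      (lookup (a ∷ b ∷ c ∷ p ∷ q ∷ []))
      ((a~b ∷ a~c ∷ a~p ∷ a≁q ∷ []) ∷ (b~c ∷ b≁p ∷ b~q ∷ []) ∷
       (c≁p ∷ c≁q ∷ []) ∷ (p≁q ∷ []) ∷ [] ∷ [])

  hammer-embedding : ∀ {a b c p q} → a ~ b → b ~ c → a ~ c → c ~ p → p ~ q →
                     a ≁ p → a ≁ q → b ≁ p → b ≁ q → c ≁ q → hammer ↪ G
  hammer-embedding {a} {b} {c} {p} {q} a~b b~c a~c c~p p~q a≁p a≁q b≁p b≁q c≁q =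
    twinFree⇒embedding hammer G (from-yes (twinFree? hammer))
      (lookup (a ∷ b ∷ c ∷ p ∷ q ∷ []))
      ((a~b ∷ a~c ∷ a≁p ∷ a≁q ∷ []) ∷ (b~c ∷ b≁p ∷ b≁q ∷ []) ∷
       (c~p ∷ c≁q ∷ []) ∷ (p~q ∷ []) ∷ [] ∷ [])

-- Minimal transversals of the cliques of size `n`.

module _ (G : Graph) (n : ℕ) where

  -- Phrased as the absence of an avoiding clique, so that a failure decided by `avoidingClique?`
  -- hands over such a clique.
  IsTransversal : Subset (order G) → Set
  IsTransversal S =
    ¬ (∃[ Q ] IsClique G Q × ∣ Q ∣ ≡ n × (∀ x → x ∈ S → x ∉ Q))

  avoidingClique? : ∀ S → Dec (∃[ Q ] IsClique G Q × ∣ Q ∣ ≡ n × (∀ x → x ∈ S → x ∉ Q))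
  avoidingClique? S = anySubset? λ Q → isClique? G Q ×-dec (∣ Q ∣ ℕ.≟ n) ×-dec
    all? λ x → (x ∈? S) →-dec ¬? (x ∈? Q)

  PrivateClique : Subset (order G) → Vertex G → Set
  PrivateClique S s =
    ∃[ K ] IsClique G K × ∣ K ∣ ≡ n × s ∈ K × (∀ t → t ∈ S → t ∈ K → t ≡ s)

  -- Positivity of `n` matters: the empty set is a clique of size 0 that avoids every set.
  ⊤-isTransversal : 0 ℕ.< n → IsTransversal ⊤
  ⊤-isTransversal 0<n (Q , _ , refl , avoids) with x , x∈Q ← 0<∣p∣⇒Nonempty Q 0<n =
    avoids x ∈⊤ x∈Q

  minimalTransversal : 0 ℕ.< n →
    ∃[ S ] IsTransversal S × (∀ {s} → s ∈ S → PrivateClique S s)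
  minimalTransversal 0<n
    with least (λ j → anySubset? λ S → ¬? (avoidingClique? S) ×-dec (∣ S ∣ ℕ.≟ j))
               (∣ ⊤ {order G} ∣) (⊤ , ⊤-isTransversal 0<n , refl)
  ... | _ , (S , transversal , refl) , minimal = S , transversal , privateClique
    where
    privateClique : ∀ {s} → s ∈ S → PrivateClique S s
    privateClique {s} s∈S with avoidingClique? (S - s)
    -- `S - s` would be a smaller transversal.
    ... | no transversal′ =
          contradiction (minimal (S - s , transversal′ , refl)) (ℕ.<⇒≱ (x∈p⇒∣p-x∣<∣p∣ s∈S))
    ... | yes (K , clique , size , avoids) = K , clique , size , s∈K , only-s
      where
      only-s : ∀ t → t ∈ S → t ∈ K → t ≡ s
      only-s t t∈S t∈K = decidable-stable (t ≟ᶠ s) λ t≢s →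
        avoids t (x∈p∧x≢y⇒x∈p-y t∈S t≢s) t∈K

      -- A clique that avoids `S - s` and omits `s` would avoid all of `S`.
      s∈K : s ∈ K
      s∈K = decidable-stable (s ∈? K) λ s∉K → transversal
        (K , clique , size , λ t t∈S t∈K → s∉K (subst (_∈ K) (only-s t t∈S t∈K) t∈K))

-- The inequality `ω G ≤ n` in a form that applies directly to any clique constructed later.
CliquesBoundedBy : Graph → ℕ → Set
CliquesBoundedBy G n = ∀ {k} → HasClique G k → k ≤ n

-- No triangles inside a minimal transversal.

module _ {G : Graph} {n : ℕ} (bounded : CliquesBoundedBy G n) (C₄-free : ¬ (C₄ ↪ G))
         {S : Subset (order G)} (privateClique : ∀ {s} → s ∈ S → PrivateClique G n S s)
         where
  private
    infix 4 _~_ _≁_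
    _~_ _≁_ : Vertex G → Vertex G → Set
    u ~ v = Adj G u v
    u ≁ v = ¬ Adj G u v

    K : ∀ {s} → s ∈ S → Subset (order G)
    K = proj₁ ∘ privateClique

    K-clique : ∀ {s} (s∈S : s ∈ S) → IsClique G (K s∈S)
    K-clique = proj₁ ∘ proj₂ ∘ privateClique

    ∣K∣ : ∀ {s} (s∈S : s ∈ S) → ∣ K s∈S ∣ ≡ n
    ∣K∣ = proj₁ ∘ proj₂ ∘ proj₂ ∘ privateClique

    s∈K : ∀ {s} (s∈S : s ∈ S) → s ∈ K s∈S
    s∈K = proj₁ ∘ proj₂ ∘ proj₂ ∘ proj₂ ∘ privateClique

    t∉K : ∀ {s t} (s∈S : s ∈ S) → t ∈ S → s ~ t → t ∉ K s∈S
    t∉K s∈S t∈S s~t t∈K =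
      Graph.irrefl G (sym (proj₂ (proj₂ (proj₂ (proj₂ (privateClique s∈S)))) _ t∈S t∈K)) s~t

    symm : ∀ {u v} → u ~ v → v ~ u
    symm = Graph.symm G

    -- Since `t` is adjacent to `s` but not to `k`, the members `s` and `k` of the clique are
    -- distinct.
    s~k : ∀ {s t k} (s∈S : s ∈ S) → s ~ t → k ∈ K s∈S → t ≁ k → s ~ k
    s~k s∈S s~t k∈K t≁k = K-clique s∈S _ _ (s∈K s∈S) k∈K
      λ { refl → t≁k (symm s~t) }

    t≢k : ∀ {s t k} (s∈S : s ∈ S) → t ∈ S → s ~ t → k ∈ K s∈S → t ≢ k
    t≢k s∈S t∈S s~t k∈K refl = t∉K s∈S t∈S s~t k∈K

  -- Otherwise adding `t` to K(s) gives a clique with more than `n` vertices.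
  notComplete : ∀ {s t} (s∈S : s ∈ S) → t ∈ S → s ~ t → ¬ (∀ k → k ∈ K s∈S → t ~ k)
  notComplete {t = t} s∈S t∈S s~t t~K = ℕ.<⇒≱
    (subst (ℕ._< ∣ ⁅ t ⁆ ∪ K s∈S ∣) (∣K∣ s∈S) (∣p∣<∣⁅x⁆∪p∣ (t∉K s∈S t∈S s~t)))
    (bounded (_ , ∪-isClique G (K-clique s∈S) t~K , refl))

  missed : ∀ {s t} (s∈S : s ∈ S) → t ∈ S → s ~ t → ∃[ k ] k ∈ K s∈S × t ≁ k
  missed {s} {t} s∈S t∈S s~t
    with k , k-missed ← ¬∀⟶∃¬ (order G) (λ k → k ∈ K s∈S → t ~ k)
                          (λ k → (k ∈? K s∈S) →-dec adj? G t k)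
                          (notComplete s∈S t∈S s~t)
    = k , decidable-stable (k ∈? K s∈S) (λ k∉K → k-missed λ k∈K → contradiction k∈K k∉K)
    , λ t~k → k-missed λ _ → t~k

  -- If `k ~ k′`, then `s`, `k`, `k′`, `t` in this cyclic order induce a `C₄`.
  missed-≁ : ∀ {s t k k′} (s∈S : s ∈ S) (t∈S : t ∈ S) → s ~ t →
             k ∈ K s∈S → t ≁ k → k′ ∈ K t∈S → s ≁ k′ → k ≁ k′
  missed-≁ s∈S t∈S s~t k∈K t≁k k′∈K s≁k′ k~k′ = C₄-free
    (C₄-embedding G (s~k s∈S s~t k∈K t≁k) k~k′ (symm (s~k t∈S (symm s~t) k′∈K s≁k′)) s~t
      s≁k′ (t≁k ∘ symm) (t≢k t∈S s∈S (symm s~t) k′∈K) (t≢k s∈S t∈S s~t k∈K ∘ sym))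

  -- Let `t` miss `k` and `u` miss `l`. If neither vertex is missed by both, then `t`, `l`, `k`, `u`
  -- in this cyclic order induce a `C₄`.
  commonMissed : ∀ {s t u} (s∈S : s ∈ S) → t ∈ S → u ∈ S → s ~ t → s ~ u → t ~ u →
                 ∃[ k ] k ∈ K s∈S × t ≁ k × u ≁ k
  commonMissed {s} {t} {u} s∈S t∈S u∈S s~t s~u t~u
    with k , k∈K , t≁k ← missed s∈S t∈S s~t
       | l , l∈K , u≁l ← missed s∈S u∈S s~u
    with adj? G u k | adj? G t l
  ... | no u≁k  | _       = k , k∈K , t≁k , u≁k
  ... | yes _   | no t≁l  = l , l∈K , t≁l , u≁l
  ... | yes u~k | yes t~l = contradiction
        (C₄-embedding G t~l l~k (symm u~k) t~u t≁k (u≁l ∘ symm)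
          (t≢k s∈S t∈S s~t k∈K) (t≢k s∈S u∈S s~u l∈K ∘ sym))
        C₄-free
    where
    l~k : l ~ k
    l~k = K-clique s∈S l k l∈K k∈K λ { refl → u≁l u~k }

  bull-free⇒triangle-free : ¬ (bull ↪ G) → ∀ {s t u} → s ∈ S → t ∈ S → u ∈ S →
                            s ~ t → s ~ u → ¬ t ~ u
  bull-free⇒triangle-free bull-free s∈S t∈S u∈S s~t s~u t~u
    with k  , k∈K  , t≁k  , u≁k  ← commonMissed s∈S t∈S u∈S s~t s~u t~u
       | k′ , k′∈K , s≁k′ , u≁k′ ← commonMissed t∈S s∈S u∈S (symm s~t) t~u s~u
    -- The triangle is `s`, `t`, `u`, with `k` pendant at `s` and `k′` pendant at `t`.
    = bull-free (bull-embedding G s~t t~u s~u (s~k s∈S s~t k∈K t≁k)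
        (s~k t∈S (symm s~t) k′∈K s≁k′) s≁k′ t≁k u≁k u≁k′
        (missed-≁ s∈S t∈S s~t k∈K t≁k k′∈K s≁k′))

  hammer-free⇒missed-unique : ¬ (hammer ↪ G) → ∀ {s t j k} (s∈S : s ∈ S) → t ∈ S → s ~ t →
                              j ∈ K s∈S → t ≁ j → k ∈ K s∈S → t ≁ k → j ≡ k
  hammer-free⇒missed-unique hammer-free {j = j} {k} s∈S t∈S s~t j∈K t≁j k∈K t≁k
    with k′ , k′∈K , s≁k′ ← missed t∈S s∈S (symm s~t)
    -- The hammer consists of the triangle `j`, `k`, `s` and the path `s`, `t`, `k′`.
    = decidable-stable (j ≟ᶠ k) λ j≢k → hammer-free
        (hammer-embedding G (K-clique s∈S j k j∈K k∈K j≢k)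
          (symm (s~k s∈S s~t k∈K t≁k)) (symm (s~k s∈S s~t j∈K t≁j)) s~t
          (s~k t∈S (symm s~t) k′∈K s≁k′)
          (t≁j ∘ symm) (missed-≁ s∈S t∈S s~t j∈K t≁j k′∈K s≁k′)
          (t≁k ∘ symm) (missed-≁ s∈S t∈S s~t k∈K t≁k k′∈K s≁k′) s≁k′)

  hammer-free⇒triangle-free : ¬ (hammer ↪ G) → ∀ {s t u} → s ∈ S → t ∈ S → u ∈ S →
                              s ~ t → s ~ u → ¬ t ~ u
  hammer-free⇒triangle-free hammer-free {s} {t} {u} s∈S t∈S u∈S s~t s~u t~u
    with k , k∈K , t≁k , u≁k ← commonMissed s∈S t∈S u∈S s~t s~u t~u
    = ℕ.<-irrefl refl (begin-strict
        n                ≡⟨ ∣K∣ s∈S ⟨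
        ∣ K s∈S ∣        ≤⟨ ∣p∣≤1+∣p-x∣ (K s∈S) k ⟩
        suc ∣ L ∣        ≤⟨ ∣p∣<∣⁅x⁆∪p∣ (t∉K s∈S t∈S s~t ∘ L⊆K) ⟩
        ∣ ⁅ t ⁆ ∪ L ∣    <⟨ ∣p∣<∣⁅x⁆∪p∣ u∉ ⟩
        ∣ ⁅ u ⁆ ∪ (⁅ t ⁆ ∪ L) ∣
                         ≤⟨ bounded (_ , ∪-isClique G (∪-isClique G L-clique t~L) u~ , refl) ⟩
        n ∎)
    where
    open ℕ.≤-Reasoning

    L : Subset (order G)
    L = K s∈S - k

    L⊆K : L ⊆ K s∈S
    L⊆K = p─q⊆p (K s∈S) ⁅ k ⁆

    L-clique : IsClique G L
    L-clique x y x∈L y∈L = K-clique s∈S x y (L⊆K x∈L) (L⊆K y∈L)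

    -- A vertex of `L` missed by `v` would equal `k` by uniqueness, but `k` has been removed.
    complete-to-L : ∀ {v} → v ∈ S → s ~ v → v ≁ k → ∀ x → x ∈ L → v ~ x
    complete-to-L {v} v∈S s~v v≁k x x∈L = decidable-stable (adj? G v x) λ v≁x →
      x∉p-x (K s∈S) k (subst (_∈ L)
        (hammer-free⇒missed-unique hammer-free s∈S v∈S s~v (L⊆K x∈L) v≁x k∈K v≁k) x∈L)

    t~L : ∀ x → x ∈ L → t ~ x
    t~L = complete-to-L t∈S s~t t≁k

    u~ : ∀ x → x ∈ ⁅ t ⁆ ∪ L → u ~ x
    u~ x x∈ with x∈p∪q⁻ ⁅ t ⁆ L x∈
    ... | inj₁ x≡t rewrite x∈⁅y⁆⇒x≡y t x≡t = symm t~u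
    ... | inj₂ x∈L = complete-to-L u∈S s~u u≁k x x∈L

    -- As `u` is adjacent to the whole set, membership would make it adjacent to itself.
    u∉ : u ∉ ⁅ t ⁆ ∪ L
    u∉ u∈ = Graph.irrefl G refl (u~ u u∈)

  triangle-free : ∀ {H} → H ≡ bull ⊎ H ≡ hammer → ¬ (H ↪ G) → ∀ {s t u} →
                  s ∈ S → t ∈ S → u ∈ S → s ~ t → s ~ u → ¬ t ~ u
  triangle-free (inj₁ refl) = bull-free⇒triangle-free
  triangle-free (inj₂ refl) = hammer-free⇒triangle-free

-- Combining colourings, and clique bounds for the two pieces.

Colourable-mono : (G : Graph) {j k : ℕ} → j ≤ k → Colourable G j → Colourable G k
Colourable-mono G j≤k (f , proper) =
    (λ v → inject≤ (f v) j≤k)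
  , λ u v u~v eq → proper u v u~v (inject≤-injective j≤k j≤k _ _ eq)

-- The two pieces receive disjoint palettes, so only edges within one piece need checking.
Colourable-∁ : (G : Graph) (S : Subset (order G)) {a b : ℕ} →
               Colourable (induced G S) a → Colourable (induced G (∁ S)) b →
               Colourable G (a + b)
Colourable-∁ G S {a} {b} (f , f-proper) (g , g-proper) =
    (λ v → join a b (colour v (v ∈? S)))
  , λ u v u~v eq → proper u~v (u ∈? S) (v ∈? S) (join-injective eq)
  where
  join-injective : ∀ {x y} → join a b x ≡ join a b y → x ≡ y
  join-injective {x} {y} eq =
    trans (sym (splitAt-join a b x)) (trans (cong (splitAt a) eq) (splitAt-join a b y))

  -- The decision is an argument, so that `proper` can split on it and let `colour` compute.
  colour : ∀ v → Dec (v ∈ S) → Fin a ⊎ Fin b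
  colour v (yes v∈S) = inj₁ (f (index v∈S))
  colour v (no  v∉S) = inj₂ (g (index (x∉p⇒x∈∁p v∉S)))

  lift : ∀ {T u v} (u∈T : u ∈ T) (v∈T : v ∈ T) → Adj G u v →
         Adj (induced G T) (index u∈T) (index v∈T)
  lift u∈T v∈T = subst₂ (Adj G) (sym (element-index u∈T)) (sym (element-index v∈T))

  proper : ∀ {u v} → Adj G u v → (u∈?S : Dec (u ∈ S)) (v∈?S : Dec (v ∈ S)) →
           colour u u∈?S ≢ colour v v∈?S
  proper u~v (yes u∈S) (yes v∈S) eq = f-proper _ _ (lift u∈S v∈S u~v) (inj₁-injective eq)
  proper u~v (no  u∉S) (no  v∉S) eq =
    g-proper _ _ (lift (x∉p⇒x∈∁p u∉S) (x∉p⇒x∈∁p v∉S) u~v) (inj₂-injective eq)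

-- A single vertex is already a clique of size 1, so the graph has no vertices.
noCliques⇒Colourable-0 : (G : Graph) → CliquesBoundedBy G 0 → Colourable G 0
noCliques⇒Colourable-0 G bounded = ⊥-elim ∘ noVertex , λ u → ⊥-elim (noVertex u)
  where
  noVertex : ¬ Vertex G
  noVertex v = ℕ.1+n≰n (bounded (⁅ v ⁆ , singleton-clique , ∣⁅x⁆∣≡1 v))
    where
    singleton-clique : IsClique G ⁅ v ⁆
    singleton-clique x y x∈ y∈ x≢y =
      contradiction (trans (x∈⁅y⁆⇒x≡y v x∈) (sym (x∈⁅y⁆⇒x≡y v y∈))) x≢y

triangle-free⇒ω≤2 : (G : Graph) (S : Subset (order G)) →
  (∀ {s t u} → s ∈ S → t ∈ S → u ∈ S → Adj G s t → Adj G s u → ¬ Adj G t u) →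
  ω (induced G S) ≤ 2
-- Matching on `cliqueNumber` exposes `ω` as the size of an actual clique `Q`.
triangle-free⇒ω≤2 G S triangle-free with cliqueNumber (induced G S)
... | _ , (Q , clique , refl) , _ = ℕ.≮⇒≥ λ 3≤∣Q∣ →
  let x , y , z , x∈Q , y∈Q , z∈Q , x≢y , x≢z , y≢z = threeElements Q 3≤∣Q∣ in
  triangle-free (element-∈ S x) (element-∈ S y) (element-∈ S z)
    (clique x y x∈Q y∈Q x≢y) (clique x z x∈Q z∈Q x≢z) (clique y z y∈Q z∈Q y≢z)

-- A clique of size `suc n` outside `S` would expand to one in `G` that `S` fails to meet.
transversal⇒CliquesBoundedBy : (G : Graph) {n : ℕ} {S : Subset (order G)} →
  CliquesBoundedBy G (suc n) → IsTransversal G (suc n) S →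
  CliquesBoundedBy (induced G (∁ S)) n
transversal⇒CliquesBoundedBy G {n} {S} bounded transversal (Q , clique , refl) =
  ℕ.≤-pred (ℕ.≤∧≢⇒< (bounded (Q′ , Q′-clique , ∣expand∣ (∁ S) Q))
    λ size → transversal (Q′ , Q′-clique , trans (∣expand∣ (∁ S) Q) size , avoids))
  where
  Q′ : Subset (order G)
  Q′ = expand (∁ S) Q

  Q′-clique : IsClique G Q′
  Q′-clique = expand-isClique G (∁ S) clique

  avoids : ∀ x → x ∈ S → x ∉ Q′
  avoids x x∈S x∈Q′ with i , _ , refl ← ∈-expand⁻ (∁ S) Q x∈Q′ =
    x∈∁p⇒x∉p (element-∈ (∁ S) i) x∈S

-- Induction and the linear binding function.

module _ {H : Graph} (bull⊎hammer : H ≡ bull ⊎ H ≡ hammer) {F : Pred Graph ℓ}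
         (F-hereditary : Hereditary F)
         {m : ℕ} (χ≤m : ∀ {G} → F G → ω G ≤ 2 → χ G ≤ m) where

  private
    C∩F : Pred Graph _
    C∩F = Free (C₄ ∷ H ∷ []) ∩ F

  -- The induction is on an upper bound for the clique number. Each round spends `m` colours on a
  -- minimal transversal and lowers the bound by one; `suc n * m` unfolds to `m + n * m`.
  CliquesBoundedBy⇒Colourable : ∀ n {G} → C∩F G → CliquesBoundedBy G n →
                                Colourable G (n * m)
  CliquesBoundedBy⇒Colourable zero {G} _ bounded = noCliques⇒Colourable-0 G bounded
  CliquesBoundedBy⇒Colourable (suc n) {G} CFG@(C₄-free ∷ H-free ∷ [] , FG) bounded
    with S , transversal , privateClique ← minimalTransversal G (suc n) (s≤s z≤n)
    = Colourable-∁ G S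
        (Colourable-mono (induced G S)
          (χ≤m (F-hereditary FG (induced-↪ G S)) (triangle-free⇒ω≤2 G S
            (triangle-free bounded C₄-free privateClique bull⊎hammer H-free)))
          (proj₁ (proj₂ (chromaticNumber (induced G S)))))
        (CliquesBoundedBy⇒Colourable n
          (∩-hereditary (Free-hereditary _) F-hereditary CFG (induced-↪ G (∁ S)))
          (transversal⇒CliquesBoundedBy G bounded transversal))

  χ≤ω*m : ∀ {G} → C∩F G → χ G ≤ ω G * m
  χ≤ω*m {G} CFG = proj₂ (proj₂ (chromaticNumber G))
    (CliquesBoundedBy⇒Colourable (ω G) CFG (proj₂ (proj₂ (cliqueNumber G))))

theorem1p3 : (ℓ : Level) (H : Graph) → H ≡ bull ⊎ H ≡ hammer →
    StronglyLinearPollyanna ℓ 2 (Free (C₄ ∷ H ∷ []))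
theorem1p3 ℓ H bull⊎hammer F (F-hereditary , m , χ≤m) =
  -- The leading coefficient is 1 + m since m may be 0.
  (λ x → suc m * x + 0) , (suc m , 0 , _ , λ _ → refl) , λ {G} {K} CFG K↪G →
  begin
    χ K                ≤⟨ χ≤ω*m bull⊎hammer F-hereditary χ≤m
                            (∩-hereditary (Free-hereditary _) F-hereditary CFG K↪G) ⟩
    -- The factor `m` moves to the front because `suc m * ω K` unfolds to `ω K + m * ω K`.
    ω K * m            ≡⟨ ℕ.*-comm (ω K) m ⟩
    m * ω K            ≤⟨ ℕ.m≤n+m (m * ω K) (ω K) ⟩
    suc m * ω K        ≡⟨ ℕ.+-identityʳ (suc m * ω K) ⟨
    suc m * ω K + 0    ∎
  where open ℕ.≤-Reasoning
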